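{- Let $V$ be a set of $n\ge 2$ vertices. The maximum number of Hamiltonian paths on $V$ such that the union of any two distinct paths of the family contains a triangle is equal to the number of balanced bipartitions of $V$ (that is, the number of unordered partitions $\{A,B\}$ of $V$ with $||A|-|B||\le 1$; equivalently $\binom{2m+1}{m}$ both for $n=2m+1$ and for $n=2m+2$).
   Context: A Hamiltonian path on $V$ is a subgraph of the complete graph on $V$ that is a path (of length $n-1$) through all vertices of $V$; it is regarded as an (unordered) edge set, so a path and its reversal are the same. The union of two graphs on the same vertex set $V$ is the graph on $V$ whose edge set is the union of their edge sets. "Contains a triangle" means contains three pairwise adjacent vertices. -}

module Defs where

open import Data.Nat using (ℕ; zero; suc; _∸_; _/_; _+_; _*_)
open import Data.Nat.Combinatorics using (_C_)
open import Data.Fin using (Fin; toℕ)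
open import Data.Product using (Σ; ∃; ∃-syntax; _×_; _,_)
open import Data.Sum using (_⊎_)
open import Relation.Binary.PropositionalEquality using (_≡_; _≢_)
open import Relation.Nullary using (¬_)
open import Function.Definitions using (Injective)

-- A Hamiltonian path on V = Fin n, given by an ordering of all vertices
-- (an injective, hence bijective, map Fin n → Fin n).  As an object it is
-- identified with its edge set `PathEdge` below (so a path and its reversal
-- are "the same"; see `SameEdges`).
record HamPath (n : ℕ) : Set where
  field
    ord : Fin n → Fin n
    inj : Injective _≡_ _≡_ ord
open HamPath public

PathEdge : ∀ {n} → HamPath n → Fin n → Fin n → Set
PathEdge P u v =
  ∃[ i ] ∃[ j ] (toℕ j ≡ suc (toℕ i)) ×
    ((ord P i ≡ u × ord P j ≡ v) ⊎ (ord P i ≡ v × ord P j ≡ u))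

SameEdges : ∀ {n} → HamPath n → HamPath n → Set
SameEdges P Q = ∀ u v → (PathEdge P u v → PathEdge Q u v) × (PathEdge Q u v → PathEdge P u v)

UnionEdge : ∀ {n} → HamPath n → HamPath n → Fin n → Fin n → Set
UnionEdge P Q u v = PathEdge P u v ⊎ PathEdge Q u v

UnionHasTriangle : ∀ {n} → HamPath n → HamPath n → Set
UnionHasTriangle P Q =
  ∃[ x ] ∃[ y ] ∃[ z ] (x ≢ y) × (y ≢ z) × (x ≢ z) ×
    UnionEdge P Q x y × UnionEdge P Q y z × UnionEdge P Q x z

TriangleFamily : ∀ {n} (k : ℕ) → (Fin k → HamPath n) → Set
TriangleFamily k F =
  ∀ i j → i ≢ j → ¬ SameEdges (F i) (F j) × UnionHasTriangle (F i) (F j)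

-- Number of balanced bipartitions of an n-set, in the closed form given in
-- the statement: C(2m+1, m) where n = 2m+1 or n = 2m+2, i.e. m = ⌊(n-1)/2⌋.
balancedBipartitions : ℕ → ℕ
balancedBipartitions n = (2 * ((n ∸ 1) / 2) + 1) C ((n ∸ 1) / 2)

{-# OPTIONS --safe #-}

-- Upper bound: a path colours its vertices alternately, and if two paths give the same
-- bipartition then their union is bipartite, hence contains no triangle.
--
-- Lower bound for 2m + 1 vertices (for 2m + 2, append the new vertex to every path).  Given a
-- colouring with m trues, insert the vertices one at a time into a binary counter whose slot l
-- is empty or holds a monochromatic group, a list of 2^l vertices.  When two groups meet in a
-- slot, equal colours make them merge, with their heads becoming consecutive, and carry;
-- different colours make them leave the counter as a block.  Interleaving the two groups of a
-- block, and likewise the false and the true groups remaining in the counter, gives an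
-- alternating path in which elements consecutive in a group are at distance two and the heads
-- of the two groups of a block are adjacent.
--
-- Run this on two colourings simultaneously.  At the first moment when two groups merge in
-- one run and form a block in the other, their heads are adjacent in one path and at distance
-- two in the other, which is a triangle.  If this never happens, then both runs have the same
-- groups up to colour; those left in the counter have the same colours, since their sizes are
-- distinct powers of two and the number of trues is the same.  So the paths agree up to the
-- first block whose two groups are exchanged, and its heads form a triangle with the vertex
-- before it.
module Submission where

open import Defs
open import Data.Bool using (Bool; true; false; not)
open import Data.Bool.Properties using (not-¬)
open import Data.Empty using (⊥)
open import Data.Fin using (Fin; zero; suc; toℕ; cast; _≟_)
open import Data.Fin.Permutation using (permutation)
open import Data.Fin.Properties using (any?; injective⇒≤; toℕ-cast; cast-involutive; punchOut-injective)
open import Data.List using (List; []; _∷_; [_]; _++_; _ʳ++_; length; lookup; map; concatMap; foldr; tabulate; allFin)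
open import Data.List.Properties
  using (length-++; length-ʳ++; length-map; length-tabulate; ++-assoc; ++-identityʳ; concatMap-++)
open import Data.List.Membership.Propositional using (_∈_)
open import Data.List.Membership.Propositional.Properties
  using (∈-map⁺; ∈-map⁻; ∈-++⁺ˡ; ∈-++⁺ʳ; ∈-lookup; ∈-tabulate⁺)
open import Data.List.Relation.Binary.Permutation.Propositional
  using (_↭_; ↭-refl; ↭-sym; ↭-trans; ↭-reflexive; ↭⇒↭ₛ; prep; module PermutationReasoning)
open import Data.List.Relation.Binary.Permutation.Propositional.Properties
  using (All-resp-↭; ↭-length; ++⁺; ++⁺ˡ; ++⁺ʳ; ++-comm; shifts; ++↭ʳ++)
import Data.List.Relation.Binary.Permutation.Setoid.Properties as Permutationₛ
open import Data.List.Relation.Binary.Pointwise as Pointwise using (Pointwise; []; _∷_)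
open import Data.List.Relation.Unary.All as All using (All; []; _∷_)
import Data.List.Relation.Unary.All.Properties as All
open import Data.List.Relation.Unary.AllPairs using ([]; _∷_)
open import Data.List.Relation.Unary.Any using (Any; here; there; index)
import Data.List.Relation.Unary.Any.Properties as Any
open import Data.List.Relation.Unary.Unique.Propositional using (Unique)
import Data.List.Relation.Unary.Unique.Propositional.Properties as Unique
open import Data.Maybe using (Maybe; just; nothing)
open import Data.Nat using (ℕ; zero; suc; _+_; _*_; _∸_; _/_; _≤_)
open import Data.Nat.Combinatorics using (_C_; nCk+nC[k+1]≡[n+1]C[k+1])
open import Data.Nat.Divisibility using (n∣m*n)
open import Data.Nat.DivMod using (m*n/n≡m; +-distrib-/-∣ʳ)
open import Data.Nat.Properties
  using ( +-0-commutativeMonoid; +-assoc; +-comm; +-suc; +-identityʳ; +-cancelˡ-≡; +-cancelʳ-≡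
        ; *-comm; *-suc; *-zeroʳ; *-distribˡ-+; *-distribʳ-+; *-cancelˡ-≡; suc-injective; even≢odd; 1+n≰n)
open import Data.Product using (Σ; ∃-syntax; _×_; _,_; proj₁; proj₂; uncurry; map₁)
open import Data.Sum using (_⊎_; inj₁; inj₂)
open import Data.Vec as Vec using (Vec; []; _∷_)
import Data.Vec.Properties as Vec
open import Function using (_∘_; id)
open import Function.Definitions using (Injective)
open import Relation.Binary.PropositionalEquality hiding ([_])
open import Relation.Nullary using (¬_; yes; no; contradiction)

open import Algebra.Properties.CommutativeMonoid.Sum +-0-commutativeMonoid using (sum; sum-permute; sum-cong-≗)

-- Pairs at distance one and two in a list

data Adj {A : Set} (x y : A) : List A → Set where
  here  : ∀ {zs} → Adj x y (x ∷ y ∷ zs)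
  swap  : ∀ {zs} → Adj x y (y ∷ x ∷ zs)
  there : ∀ {z zs} → Adj x y zs → Adj x y (z ∷ zs)

-- A pair that is `Skip` in one path and `Adj` in another spans a triangle together with the vertex
-- between the two.
data Skip {A : Set} (x y : A) : List A → Set where
  here  : ∀ {z zs} → Skip x y (x ∷ z ∷ y ∷ zs)
  swap  : ∀ {z zs} → Skip x y (y ∷ z ∷ x ∷ zs)
  there : ∀ {z zs} → Skip x y zs → Skip x y (z ∷ zs)

adj-++ˡ : ∀ {A : Set} {x y : A} {xs} ys → Adj x y xs → Adj x y (xs ++ ys)
adj-++ˡ ys here      = here
adj-++ˡ ys swap      = swap
adj-++ˡ ys (there a) = there (adj-++ˡ ys a)

adj-++ʳ : ∀ {A : Set} {x y : A} xs {ys} → Adj x y ys → Adj x y (xs ++ ys)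
adj-++ʳ []       a = a
adj-++ʳ (_ ∷ xs) a = there (adj-++ʳ xs a)

skip-++ˡ : ∀ {A : Set} {x y : A} {xs} ys → Skip x y xs → Skip x y (xs ++ ys)
skip-++ˡ ys here      = here
skip-++ˡ ys swap      = swap
skip-++ˡ ys (there a) = there (skip-++ˡ ys a)

skip-++ʳ : ∀ {A : Set} {x y : A} xs {ys} → Skip x y ys → Skip x y (xs ++ ys)
skip-++ʳ []       a = a
skip-++ʳ (_ ∷ xs) a = there (skip-++ʳ xs a)

adj-ʳ++ʳ : ∀ {A : Set} {x y : A} xs {ys} → Adj x y ys → Adj x y (xs ʳ++ ys)
adj-ʳ++ʳ []       a = a
adj-ʳ++ʳ (_ ∷ xs) a = adj-ʳ++ʳ xs (there a)

adj-ʳ++ˡ : ∀ {A : Set} {x y : A} {xs} ys → Adj x y xs → Adj x y (xs ʳ++ ys)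
adj-ʳ++ˡ ys (here {zs})           = adj-ʳ++ʳ zs swap
adj-ʳ++ˡ ys (swap {zs})           = adj-ʳ++ʳ zs here
adj-ʳ++ˡ ys (there {z} a)         = adj-ʳ++ˡ (z ∷ ys) a

-- `ʳ++` reverses its left argument, so merging two groups with it joins them at their heads.
adj-junction : ∀ {A : Set} {x y : A} xs {ys} → Adj x y ((x ∷ xs) ʳ++ (y ∷ ys))
adj-junction xs = adj-ʳ++ʳ xs here

-- Interleaving two lists

zig : ∀ {A : Set} → List A → List A → List A
zig []       ys = ys
zig (x ∷ xs) ys = x ∷ zig ys xs

-- This follows the recursion of `zig` and says that neither list runs out early: the lengths are
-- equal, or the first list is longer by one.
data Alternating {A : Set} : List A → List A → Set where
  []  : Alternating [] []
  _∷_ : ∀ x {xs ys} → Alternating ys xs → Alternating (x ∷ xs) ys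

alternating-≡ : ∀ {A : Set} (xs ys : List A) → length xs ≡ length ys → Alternating xs ys
alternating-suc : ∀ {A : Set} (xs ys : List A) → length xs ≡ suc (length ys) → Alternating xs ys

alternating-≡ []       []       _  = []
alternating-≡ (x ∷ xs) ys       eq = x ∷ alternating-suc ys xs (sym eq)

alternating-suc (x ∷ xs) ys eq = x ∷ alternating-≡ ys xs (sym (suc-injective eq))

skip-zigˡ : ∀ {A : Set} {x y : A} {xs ys} → Alternating xs ys → Adj x y xs → Skip x y (zig xs ys)
skip-zigʳ : ∀ {A : Set} {x y : A} {xs ys} → Alternating xs ys → Adj x y ys → Skip x y (zig xs ys)

-- Two further elements on the left force one on the right, and that one lands between them.
skip-zigˡ (_ ∷ (_ ∷ _)) here      = here
skip-zigˡ (_ ∷ (_ ∷ _)) swap      = swap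
skip-zigˡ (_ ∷ alt)     (there a) = there (skip-zigʳ alt a)

skip-zigʳ (_ ∷ alt) a = there (skip-zigˡ alt a)

zig-↭ : ∀ {A : Set} (xs ys : List A) → zig xs ys ↭ xs ++ ys
zig-↭ []       ys = ↭-refl
zig-↭ (x ∷ xs) ys = prep x (↭-trans (zig-↭ ys xs) (++-comm ys xs))

-- The binary counter and the path read off from it

module _ {V : Set} where

  Group : Set
  Group = Bool × List V

  Counter : Set
  Counter = List (Maybe Group)

  -- The true group is the first component, whichever of the two arrived last.
  Block : Set
  Block = List V × List V

  State : Set
  State = Counter × List Block

  insert : Group → Counter → State
  insert g           []                        = just g ∷ [] , []
  insert g           (nothing ∷ cs)            = just g ∷ cs , []
  insert (true  , g) (just (true  , h) ∷ cs)   = map₁ (nothing ∷_) (insert (true , h ʳ++ g) cs)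
  insert (false , g) (just (false , h) ∷ cs)   = map₁ (nothing ∷_) (insert (false , h ʳ++ g) cs)
  insert (true  , g) (just (false , h) ∷ cs)   = nothing ∷ cs , [ g , h ]
  insert (false , g) (just (true  , h) ∷ cs)   = nothing ∷ cs , [ h , g ]

  -- New blocks go to the front, so the path runs through the blocks from the latest to the
  -- earliest.
  step : (V → Bool) → V → State → State
  step χ v (cs , bs) = proj₁ (insert (χ v , [ v ]) cs) , proj₂ (insert (χ v , [ v ]) cs) ++ bs

  run : (V → Bool) → List V → State
  run χ = foldr (step χ) ([] , [])

  members : Bool → Counter → List V
  members b     []                      = []
  members b     (nothing ∷ cs)          = members b cs
  members true  (just (true  , g) ∷ cs) = g ++ members true cs
  members true  (just (false , g) ∷ cs) = members true cs
  members false (just (true  , g) ∷ cs) = members false cs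
  members false (just (false , g) ∷ cs) = g ++ members false cs

  zigs : List Block → List V
  zigs = concatMap (uncurry zig)

  -- The false members lead because under a balanced colouring they outnumber the true members of
  -- the counter by one.
  path : State → List V
  path (cs , bs) = zig (members false cs) (members true cs) ++ zigs bs

  flat : Counter → List V
  flat []                  = []
  flat (nothing ∷ cs)      = flat cs
  flat (just (_ , g) ∷ cs) = g ++ flat cs

  content : State → List V
  content (cs , bs) = flat cs ++ concatMap (uncurry _++_) bs

  -- Insertion and interleaving only permute the vertices

  insert-content : ∀ g cs → content (insert g cs) ↭ proj₂ g ++ flat cs
  merge-content : ∀ c g h cs →
    content (insert (c , h ʳ++ g) cs) ↭ g ++ h ++ flat cs

  merge-content c g h cs = begin
    content (insert (c , h ʳ++ g) cs)  ↭⟨ insert-content (c , h ʳ++ g) cs ⟩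
    (h ʳ++ g) ++ flat cs               ↭⟨ ++⁺ʳ (flat cs) (++↭ʳ++ h g) ⟨
    (h ++ g) ++ flat cs                ≡⟨ ++-assoc h g (flat cs) ⟩
    h ++ g ++ flat cs                  ↭⟨ shifts h g ⟩
    g ++ h ++ flat cs                  ∎
    where open PermutationReasoning

  insert-content (c , g) []             = ↭-reflexive (++-identityʳ (g ++ []))
  insert-content (c , g) (nothing ∷ cs) = ↭-reflexive (++-identityʳ (g ++ flat cs))
  insert-content (true  , g) (just (true  , h) ∷ cs) = merge-content true g h cs
  insert-content (false , g) (just (false , h) ∷ cs) = merge-content false g h cs
  insert-content (true  , g) (just (false , h) ∷ cs) = begin
    flat cs ++ (g ++ h) ++ []  ≡⟨ cong (flat cs ++_) (++-identityʳ (g ++ h)) ⟩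
    flat cs ++ g ++ h          ↭⟨ ++-comm (flat cs) (g ++ h) ⟩
    (g ++ h) ++ flat cs        ≡⟨ ++-assoc g h (flat cs) ⟩
    g ++ h ++ flat cs          ∎
    where open PermutationReasoning
  insert-content (false , g) (just (true  , h) ∷ cs) = begin
    flat cs ++ (h ++ g) ++ []  ≡⟨ cong (flat cs ++_) (++-identityʳ (h ++ g)) ⟩
    flat cs ++ h ++ g          ↭⟨ ++-comm (flat cs) (h ++ g) ⟩
    (h ++ g) ++ flat cs        ≡⟨ ++-assoc h g (flat cs) ⟩
    h ++ g ++ flat cs          ↭⟨ shifts h g ⟩
    g ++ h ++ flat cs          ∎
    where open PermutationReasoning

  run-content : ∀ χ vs → content (run χ vs) ↭ vs
  run-content χ []       = ↭-refl
  run-content χ (v ∷ vs) = begin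
    flat cs′ ++ blocks (new ++ bs)         ≡⟨ cong (flat cs′ ++_) (concatMap-++ (uncurry _++_) new bs) ⟩
    flat cs′ ++ blocks new ++ blocks bs    ≡⟨ ++-assoc (flat cs′) _ _ ⟨
    (flat cs′ ++ blocks new) ++ blocks bs  ↭⟨ ++⁺ʳ (blocks bs) (insert-content (χ v , [ v ]) cs) ⟩
    v ∷ content (run χ vs)                 ↭⟨ prep v (run-content χ vs) ⟩
    v ∷ vs                                 ∎
    where
    open PermutationReasoning
    blocks = concatMap (uncurry _++_)
    cs  = proj₁ (run χ vs)
    bs  = proj₂ (run χ vs)
    cs′ = proj₁ (insert (χ v , [ v ]) cs)
    new = proj₂ (insert (χ v , [ v ]) cs)

  members-↭ : ∀ cs → members false cs ++ members true cs ↭ flat cs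
  members-↭ []                      = ↭-refl
  members-↭ (nothing ∷ cs)          = members-↭ cs
  members-↭ (just (false , g) ∷ cs) =
    ↭-trans (↭-reflexive (++-assoc g _ _)) (++⁺ˡ g (members-↭ cs))
  members-↭ (just (true  , g) ∷ cs) =
    ↭-trans (shifts (members false cs) g) (++⁺ˡ g (members-↭ cs))

  zigs-↭ : ∀ bs → zigs bs ↭ concatMap (uncurry _++_) bs
  zigs-↭ []             = ↭-refl
  zigs-↭ ((t , f) ∷ bs) = ++⁺ (zig-↭ t f) (zigs-↭ bs)

  path-↭ : ∀ s → path s ↭ content s
  path-↭ (cs , bs) =
    ++⁺ (↭-trans (zig-↭ (members false cs) (members true cs)) (members-↭ cs)) (zigs-↭ bs)

  -- Colours and sizes of the groups

  Mono : (V → Bool) → Bool → List V → Set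
  Mono χ c = All (λ v → χ v ≡ c)

  -- The groups in slot l have 2^l elements, written as suc k so that they are visibly non-empty.
  data Good (χ : V → Bool) : ℕ → Counter → Set where
    []   : ∀ {k} → Good χ k []
    skip : ∀ {k cs} → Good χ (k + suc k) cs → Good χ k (nothing ∷ cs)
    full : ∀ {k c g cs} → length g ≡ suc k → Mono χ c g →
           Good χ (k + suc k) cs → Good χ k (just (c , g) ∷ cs)

  GoodBlock : (V → Bool) → Block → Set
  GoodBlock χ (t , f) = ∃[ k ] length t ≡ suc k × length f ≡ suc k × Mono χ true t × Mono χ false f

  GoodBlocks : (V → Bool) → List Block → Set
  GoodBlocks χ = All (GoodBlock χ)

  length-merge : ∀ {k} (h g : List V) → length g ≡ suc k → length h ≡ suc k →
    length (h ʳ++ g) ≡ suc (k + suc k)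
  length-merge h g eg eh = trans (length-ʳ++ h) (cong₂ _+_ eh eg)

  mono-merge : ∀ {χ c} {h g : List V} → Mono χ c h → Mono χ c g → Mono χ c (h ʳ++ g)
  mono-merge {h = h} {g} mh mg = All-resp-↭ (++↭ʳ++ h g) (All.++⁺ mh mg)

  insert-good : ∀ {χ k c} g {cs} → length g ≡ suc k → Mono χ c g → Good χ k cs →
    Good χ k (proj₁ (insert (c , g) cs)) × GoodBlocks χ (proj₂ (insert (c , g) cs))
  insert-good g eg mg []        = full eg mg [] , []
  insert-good g eg mg (skip G)  = full eg mg G , []
  insert-good {c = true}  g eg mg (full {c = true} {h} eh mh G) =
    map₁ skip (insert-good _ (length-merge h g eg eh) (mono-merge mh mg) G)
  insert-good {c = false} g eg mg (full {c = false} {h} eh mh G) =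
    map₁ skip (insert-good _ (length-merge h g eg eh) (mono-merge mh mg) G)
  insert-good {c = true}  g eg mg (full {c = false} eh mh G) = skip G , (_ , eg , eh , mg , mh) ∷ []
  insert-good {c = false} g eg mg (full {c = true}  eh mh G) = skip G , (_ , eh , eg , mh , mg) ∷ []

  run-good : ∀ χ vs → Good χ 0 (proj₁ (run χ vs)) × GoodBlocks χ (proj₂ (run χ vs))
  run-good χ []       = [] , []
  run-good χ (v ∷ vs) with run-good χ vs
  ... | G , B with insert-good {c = χ v} [ v ] refl (refl ∷ []) G
  ... | G′ , B′ = G′ , All.++⁺ B′ B

  -- Counting the vertices of each colour

  weight : Bool → Bool → ℕ → ℕ
  weight true  true  n = n
  weight false false n = n
  weight true  false n = 0
  weight false true  n = 0

  count : Bool → (V → Bool) → List V → ℕ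
  count b χ []       = 0
  count b χ (v ∷ vs) = weight b (χ v) 1 + count b χ vs

  -- Both groups of a good block have the same length, so this is the contribution of the blocks to
  -- either colour.
  halves : List Block → ℕ
  halves []             = 0
  halves ((t , _) ∷ bs) = length t + halves bs

  halves-++ : ∀ bs bs′ → halves (bs ++ bs′) ≡ halves bs + halves bs′
  halves-++ []             bs′ = refl
  halves-++ ((t , _) ∷ bs) bs′ =
    trans (cong (length t +_) (halves-++ bs bs′)) (sym (+-assoc (length t) _ _))

  tally : Bool → State → ℕ
  tally b (cs , bs) = length (members b cs) + halves bs

  members-just : ∀ b c g cs →
    length (members b (just (c , g) ∷ cs)) ≡ weight b c (length g) + length (members b cs)
  members-just true  true  g cs = length-++ g
  members-just true  false g cs = refl
  members-just false true  g cs = refl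
  members-just false false g cs = length-++ g

  weight-+ : ∀ b c m n → weight b c (m + n) ≡ weight b c m + weight b c n
  weight-+ true  true  m n = refl
  weight-+ true  false m n = refl
  weight-+ false true  m n = refl
  weight-+ false false m n = refl

  -- A merge keeps all vertices in the counter under their colour. A split turns one group of each
  -- colour into a block, and equality of the two lengths makes `halves` account for both colours.
  insert-tally : ∀ {χ k} b c g {cs} → length g ≡ suc k → Good χ k cs →
    tally b (insert (c , g) cs) ≡ weight b c (length g) + length (members b cs)
  merge-tally : ∀ {χ k} b c h g {cs} → length g ≡ suc k → length h ≡ suc k → Good χ (k + suc k) cs →
    tally b (insert (c , h ʳ++ g) cs) ≡
      weight b c (length g) + length (members b (just (c , h) ∷ cs))

  merge-tally b c h g {cs} eg eh G = begin
    tally b (insert (c , h ʳ++ g) cs)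
      ≡⟨ insert-tally b c (h ʳ++ g) (length-merge h g eg eh) G ⟩
    weight b c (length (h ʳ++ g)) + n
      ≡⟨ cong (λ l → weight b c l + n) (trans (length-ʳ++ h) (+-comm (length h) (length g))) ⟩
    weight b c (length g + length h) + n
      ≡⟨ cong (_+ n) (weight-+ b c (length g) (length h)) ⟩
    weight b c (length g) + weight b c (length h) + n
      ≡⟨ +-assoc (weight b c (length g)) _ _ ⟩
    weight b c (length g) + (weight b c (length h) + n)
      ≡⟨ cong (weight b c (length g) +_) (members-just b c h cs) ⟨
    weight b c (length g) + length (members b (just (c , h) ∷ cs)) ∎
    where
    open ≡-Reasoning
    n = length (members b cs)

  insert-tally b c g eg [] = trans (+-identityʳ _) (members-just b c g [])
  insert-tally b c g eg (skip {cs = cs} G) = trans (+-identityʳ _) (members-just b c g cs)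
  insert-tally b true  g eg (full {c = true} {h} eh mh G) = merge-tally b true h g eg eh G
  insert-tally b false g eg (full {c = false} {h} eh mh G) = merge-tally b false h g eg eh G
  insert-tally true  true  g eg (full {c = false} {h} {cs} eh mh G) =
    trans (cong (length (members true cs) +_) (+-identityʳ _)) (+-comm _ (length g))
  insert-tally false true  g eg (full {c = false} {h} {cs} eh mh G) =
    trans (cong (length (members false cs) +_) (trans (+-identityʳ _) (trans eg (sym eh))))
      (trans (+-comm _ (length h)) (sym (length-++ h)))
  insert-tally true  false g eg (full {c = true} {h} {cs} eh mh G) =
    trans (cong (length (members true cs) +_) (+-identityʳ _))
      (trans (+-comm _ (length h)) (sym (length-++ h)))
  insert-tally false false g eg (full {c = true} {h} {cs} eh mh G) =
    trans (cong (length (members false cs) +_) (trans (+-identityʳ _) (trans eh (sym eg))))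
      (+-comm _ (length g))

  run-tally : ∀ b χ vs → tally b (run χ vs) ≡ count b χ vs
  run-tally b     χ []       = refl
  run-tally b     χ (v ∷ vs) = begin
    length (members b cs′) + halves (new ++ bs)
      ≡⟨ cong (length (members b cs′) +_) (halves-++ new bs) ⟩
    length (members b cs′) + (halves new + halves bs)
      ≡⟨ +-assoc (length (members b cs′)) _ _ ⟨
    tally b (insert (χ v , [ v ]) cs) + halves bs
      ≡⟨ cong (_+ halves bs) (insert-tally b (χ v) [ v ] refl (proj₁ (run-good χ vs))) ⟩
    weight b (χ v) 1 + length (members b cs) + halves bs
      ≡⟨ +-assoc (weight b (χ v) 1) _ _ ⟩
    weight b (χ v) 1 + tally b (run χ vs)
      ≡⟨ cong (weight b (χ v) 1 +_) (run-tally b χ vs) ⟩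
    weight b (χ v) 1 + count b χ vs ∎
    where
    open ≡-Reasoning
    cs  = proj₁ (run χ vs)
    bs  = proj₂ (run χ vs)
    cs′ = proj₁ (insert (χ v , [ v ]) cs)
    new = proj₂ (insert (χ v , [ v ]) cs)

  -- Comparing the runs of two colourings

  -- Groups agree as lists, including their order, and only the colours may differ; hence merging in
  -- both runs again produces identical groups.
  data SameShape : Counter → Counter → Set where
    []   : SameShape [] []
    skip : ∀ {cs cs′} → SameShape cs cs′ → SameShape (nothing ∷ cs) (nothing ∷ cs′)
    full : ∀ {c c′ g cs cs′} → SameShape cs cs′ →
           SameShape (just (c , g) ∷ cs) (just (c′ , g) ∷ cs′)

  data Twin : Block → Block → Set where
    same    : ∀ {t f} → Twin (t , f) (t , f)
    swapped : ∀ {t f} → Twin (t , f) (f , t)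

  Similar : State → State → Set
  Similar (cs , bs) (cs′ , bs′) = SameShape cs cs′ × Pointwise Twin bs bs′

  data Heads (x y : V) : Block → Set where
    heads : ∀ {xs ys} → Heads x y (x ∷ xs , y ∷ ys)
    heads′ : ∀ {xs ys} → Heads x y (y ∷ ys , x ∷ xs)

  Joined : V → V → State → Set
  Joined x y (_ , bs) = Any (Heads x y) bs

  data NearC (x y : V) : Counter → Set where
    here  : ∀ {c g cs} → Adj x y g → NearC x y (just (c , g) ∷ cs)
    there : ∀ {s cs} → NearC x y cs → NearC x y (s ∷ cs)

  NearB : V → V → List Block → Set
  NearB x y = Any (λ (t , f) → Adj x y t ⊎ Adj x y f)

  Near : V → V → State → Set
  Near x y (cs , bs) = NearC x y cs ⊎ NearB x y bs

  -- Heads of a block end up adjacent in the path, and neighbours inside a group end up at distance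
  -- two, so such a pair is a triangle in the making.
  Separated : State → State → Set
  Separated s s′ = ∃[ x ] ∃[ y ] (Joined x y s × Near x y s′ ⊎ Joined x y s′ × Near x y s)

  -- A view of insertion into an occupied slot. For comparing two runs, the four colour combinations
  -- matter only through whether the groups merge and in which order they are split.
  data Insertion (g : List V) (c : Bool) (h : List V) (cs : Counter) : State → Set where
    merged : Insertion g c h cs (map₁ (nothing ∷_) (insert (c , h ʳ++ g) cs))
    split  : Insertion g c h cs (nothing ∷ cs , [ g , h ])
    split′ : Insertion g c h cs (nothing ∷ cs , [ h , g ])

  insertion : ∀ c d g h cs → Insertion g c h cs (insert (c , g) (just (d , h) ∷ cs))
  insertion true  true  g h cs = merged
  insertion true  false g h cs = split
  insertion false true  g h cs = split′
  insertion false false g h cs = merged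

  near-merged : ∀ {x y} s → Near x y s → Near x y (map₁ (nothing ∷_) s)
  near-merged s (inj₁ n) = inj₁ (there n)
  near-merged s (inj₂ n) = inj₂ n

  -- Neighbours in a group stay neighbours: `ʳ++` at most reverses their order, and a split moves a
  -- group into a block unchanged.
  insert-near : ∀ {x y} c g cs → Adj x y g ⊎ NearC x y cs → Near x y (insert (c , g) cs)
  insert-near c g []             (inj₁ a)         = inj₁ (here a)
  insert-near c g (nothing ∷ cs) (inj₁ a)         = inj₁ (here a)
  insert-near c g (nothing ∷ cs) (inj₂ (there n)) = inj₁ (there n)
  insert-near c g (just (d , h) ∷ cs) n
    with insert (c , g) (just (d , h) ∷ cs) | insertion c d g h cs
  insert-near c g (just (d , h) ∷ cs) (inj₁ a)         | _ | merged =
    near-merged _ (insert-near c (h ʳ++ g) cs (inj₁ (adj-ʳ++ʳ h a)))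
  insert-near c g (just (d , h) ∷ cs) (inj₂ (here a))  | _ | merged =
    near-merged _ (insert-near c (h ʳ++ g) cs (inj₁ (adj-ʳ++ˡ g a)))
  insert-near c g (just (d , h) ∷ cs) (inj₂ (there n)) | _ | merged =
    near-merged _ (insert-near c (h ʳ++ g) cs (inj₂ n))
  insert-near c g (just (d , h) ∷ cs) (inj₁ a)         | _ | split  = inj₂ (here (inj₁ a))
  insert-near c g (just (d , h) ∷ cs) (inj₂ (here a))  | _ | split  = inj₂ (here (inj₂ a))
  insert-near c g (just (d , h) ∷ cs) (inj₂ (there n)) | _ | split  = inj₁ (there n)
  insert-near c g (just (d , h) ∷ cs) (inj₁ a)         | _ | split′ = inj₂ (here (inj₂ a))
  insert-near c g (just (d , h) ∷ cs) (inj₂ (here a))  | _ | split′ = inj₂ (here (inj₁ a))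
  insert-near c g (just (d , h) ∷ cs) (inj₂ (there n)) | _ | split′ = inj₁ (there n)

  insert-near-heads : ∀ {x y} xs ys c cs →
    Near x y (map₁ (nothing ∷_) (insert (c , (x ∷ xs) ʳ++ (y ∷ ys)) cs))
  insert-near-heads xs ys c cs = near-merged _ (insert-near c _ cs (inj₁ (adj-junction xs)))

  separated-merged : ∀ s s′ → Separated s s′ →
    Separated (map₁ (nothing ∷_) s) (map₁ (nothing ∷_) s′)
  separated-merged s s′ (x , y , inj₁ (j , n)) = x , y , inj₁ (j , near-merged s′ n)
  separated-merged s s′ (x , y , inj₂ (j , n)) = x , y , inj₂ (j , near-merged s n)

  insert-similar : ∀ {χ k} c c′ g {cs cs′} → length g ≡ suc k → Good χ k cs → SameShape cs cs′ →
    Similar (insert (c , g) cs) (insert (c′ , g) cs′) ⊎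
    Separated (insert (c , g) cs) (insert (c′ , g) cs′)
  insert-similar c c′ g eg [] []                 = inj₁ (full [] , [])
  insert-similar c c′ g eg (skip _) (skip shape) = inj₁ (full shape , [])
  insert-similar c c′ g eg (full eh _ G) (full {d} {d′} {h} {cs} {cs′} shape)
    with insert (c , g) (just (d , h) ∷ cs) | insertion c d g h cs
       | insert (c′ , g) (just (d′ , h) ∷ cs′) | insertion c′ d′ g h cs′
  ... | _ | split  | _ | split  = inj₁ (skip shape , same ∷ [])
  ... | _ | split  | _ | split′ = inj₁ (skip shape , swapped ∷ [])
  ... | _ | split′ | _ | split  = inj₁ (skip shape , swapped ∷ [])
  ... | _ | split′ | _ | split′ = inj₁ (skip shape , same ∷ [])
  -- The carried group is the same list in both runs, so the comparison continues in the next slot.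
  ... | _ | merged | _ | merged
    with insert-similar c c′ (h ʳ++ g) (length-merge h g eg eh) G shape
  ...   | inj₁ (shape′ , twins) = inj₁ (skip shape′ , twins)
  ...   | inj₂ sep              = inj₂ (separated-merged _ _ sep)
  -- In the four remaining cases one run merges and the other splits. The lengths make both groups
  -- non-empty, and their heads are the separated pair.
  insert-similar c c′ (y ∷ ys) eg (full _ _ _) (full {g = x ∷ xs} {cs} {cs′} shape) | _ | merged | _ | split  =
    inj₂ (x , y , inj₂ (here heads′ , insert-near-heads xs ys c cs))
  insert-similar c c′ (y ∷ ys) eg (full _ _ _) (full {g = x ∷ xs} {cs} {cs′} shape) | _ | merged | _ | split′ =
    inj₂ (x , y , inj₂ (here heads , insert-near-heads xs ys c cs))
  insert-similar c c′ (y ∷ ys) eg (full _ _ _) (full {g = x ∷ xs} {cs} {cs′} shape) | _ | split  | _ | merged =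
    inj₂ (x , y , inj₁ (here heads′ , insert-near-heads xs ys c′ cs′))
  insert-similar c c′ (y ∷ ys) eg (full _ _ _) (full {g = x ∷ xs} {cs} {cs′} shape) | _ | split′ | _ | merged =
    inj₂ (x , y , inj₁ (here heads , insert-near-heads xs ys c′ cs′))

  step-joined : ∀ {x y} χ v s → Joined x y s → Joined x y (step χ v s)
  step-joined χ v (cs , bs) j = Any.++⁺ʳ (proj₂ (insert (χ v , [ v ]) cs)) j

  extend-near : ∀ {x y} s bs → Near x y s → Near x y (proj₁ s , proj₂ s ++ bs)
  extend-near s bs (inj₁ n) = inj₁ n
  extend-near s bs (inj₂ n) = inj₂ (Any.++⁺ˡ n)

  step-near : ∀ {x y} χ v s → Near x y s → Near x y (step χ v s)
  step-near χ v (cs , bs) (inj₁ n) = extend-near _ bs (insert-near (χ v) [ v ] cs (inj₂ n))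
  step-near χ v (cs , bs) (inj₂ n) = inj₂ (Any.++⁺ʳ (proj₂ (insert (χ v , [ v ]) cs)) n)

  -- A separation is permanent, since later steps never alter a block and preserve neighbours in a
  -- group. Up to the first separation the two runs stay similar.
  run-similar : ∀ χ χ′ vs → Similar (run χ vs) (run χ′ vs) ⊎ Separated (run χ vs) (run χ′ vs)
  run-similar χ χ′ []       = inj₁ ([] , [])
  run-similar χ χ′ (v ∷ vs) with run-similar χ χ′ vs
  ... | inj₂ (x , y , inj₁ (j , n)) =
    inj₂ (x , y , inj₁ (step-joined χ v (run χ vs) j , step-near χ′ v (run χ′ vs) n))
  ... | inj₂ (x , y , inj₂ (j , n)) =
    inj₂ (x , y , inj₂ (step-joined χ′ v (run χ′ vs) j , step-near χ v (run χ vs) n))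
  ... | inj₁ (shape , twins)
    with insert-similar (χ v) (χ′ v) [ v ] refl (proj₁ (run-good χ vs)) shape
  ...   | inj₁ (shape′ , twins′) = inj₁ (shape′ , Pointwise.++⁺ twins′ twins)
  ...   | inj₂ (x , y , inj₁ (j , n)) = inj₂ (x , y , inj₁ (Any.++⁺ˡ j , extend-near _ _ n))
  ...   | inj₂ (x , y , inj₂ (j , n)) = inj₂ (x , y , inj₂ (Any.++⁺ˡ j , extend-near _ _ n))

  -- From runs to crossing paths

  Crossing : List V → List V → Set
  Crossing xs ys = ∃[ u ] ∃[ v ] (Adj u v xs × Skip u v ys ⊎ Adj u v ys × Skip u v xs)

  joined-path : ∀ {x y} s → Joined x y s → Adj x y (path s)
  joined-path (cs , bs) j = adj-++ʳ (zig (members false cs) (members true cs)) (joined bs j)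
    where
    joined : ∀ {x y} bs → Any (Heads x y) bs → Adj x y (zigs bs)
    joined (_ ∷ bs) (here heads) = here
    joined (_ ∷ bs) (here heads′) = swap
    joined ((t , f) ∷ bs) (there j) = adj-++ʳ (zig t f) (joined bs j)

  near-members : ∀ {x y cs} → NearC x y cs → ∃[ b ] Adj x y (members b cs)
  near-members (here {true}  a) = true  , adj-++ˡ _ a
  near-members (here {false} a) = false , adj-++ˡ _ a
  near-members {cs = nothing ∷ _} (there n) = near-members n
  near-members {cs = just (c , g) ∷ _} (there n) with c | near-members n
  ... | true  | true  , a = true  , adj-++ʳ g a
  ... | true  | false , a = false , a
  ... | false | true  , a = true  , a
  ... | false | false , a = false , adj-++ʳ g a

  AlternatingState : State → Set
  AlternatingState (cs , bs) =
    length (members false cs) ≡ suc (length (members true cs))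

  -- The groups of a block have equal length and the counter has one more false member than true
  -- ones, so both kinds of interleaving alternate up to the end.
  near-path : ∀ {χ x y} s → GoodBlocks χ (proj₂ s) → AlternatingState s →
    Near x y s → Skip x y (path s)
  near-path (cs , bs) B alt (inj₁ n) with near-members n
  ... | false , a = skip-++ˡ _ (skip-zigˡ (alternating-suc (members false cs) _ alt) a)
  ... | true  , a = skip-++ˡ _ (skip-zigʳ (alternating-suc (members false cs) _ alt) a)
  near-path {χ} {x} {y} (cs , bs) B alt (inj₂ n) =
    skip-++ʳ (zig (members false cs) (members true cs)) (near bs B n)
    where
    near : ∀ bs → GoodBlocks χ bs → NearB x y bs → Skip x y (zigs bs)
    near ((t , f) ∷ bs) ((_ , et , ef , _) ∷ B) (here (inj₁ a)) =
      skip-++ˡ _ (skip-zigˡ (alternating-≡ t f (trans et (sym ef))) a)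
    near ((t , f) ∷ bs) ((_ , et , ef , _) ∷ B) (here (inj₂ a)) =
      skip-++ˡ _ (skip-zigʳ (alternating-≡ t f (trans et (sym ef))) a)
    near ((t , f) ∷ bs) (_ ∷ B) (there n) = skip-++ʳ (zig t f) (near bs B n)

  -- Binary expansion of the number of trues in the counter

  double : ∀ k q → suc (k + suc k) * q ≡ suc k * (2 * q)
  double k q = begin
    (suc k + suc k) * q        ≡⟨ *-distribʳ-+ q (suc k) (suc k) ⟩
    suc k * q + suc k * q      ≡⟨ *-distribˡ-+ (suc k) q q ⟨
    suc k * (q + q)            ≡⟨ cong (λ r → suc k * (q + r)) (+-identityʳ q) ⟨
    suc k * (2 * q)            ∎
    where open ≡-Reasoning

  -- Group sizes double from slot to slot, so all of them from this slot on are multiples of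
  -- `suc k`, and all those beyond it are even multiples.
  members-multiple : ∀ {χ k cs} → Good χ k cs → ∃[ q ] length (members true cs) ≡ suc k * q
  members-double : ∀ {χ k cs} → Good χ (k + suc k) cs →
    ∃[ q ] length (members true cs) ≡ suc k * (2 * q)

  members-double {k = k} G with members-multiple G
  ... | q , eq = q , trans eq (double k q)

  members-multiple {k = k} [] = 0 , sym (*-zeroʳ k)
  members-multiple (skip G) with members-double G
  ... | q , eq = 2 * q , eq
  members-multiple (full {c = false} _ _ G) with members-double G
  ... | q , eq = 2 * q , eq
  members-multiple {k = k} (full {c = true} {g} eg _ G) with members-double G
  ... | q , eq = suc (2 * q) , trans (length-++ g) (trans (cong₂ _+_ eg eq) (sym (*-suc (suc k) (2 * q))))

  -- In units of `suc k`, the left side is odd because of `g`, while the right side is even.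
  slot-parity : ∀ {χ χ′ k cs cs′} (g : List V) → length g ≡ suc k →
    Good χ (k + suc k) cs → Good χ′ (k + suc k) cs′ →
    length (g ++ members true cs) ≢ length (members true cs′)
  slot-parity {k = k} {cs} {cs′} g eg G G′ eq with members-double G | members-double G′
  ... | q , e | q′ , e′ = even≢odd q′ q (*-cancelˡ-≡ _ _ (suc k) (begin
    suc k * (2 * q′)                   ≡⟨ e′ ⟨
    length (members true cs′)          ≡⟨ eq ⟨
    length (g ++ members true cs)      ≡⟨ length-++ g ⟩
    length g + length (members true cs) ≡⟨ cong₂ _+_ eg e ⟩
    suc k + suc k * (2 * q)            ≡⟨ *-suc (suc k) (2 * q) ⟨
    suc k * suc (2 * q)                ∎))
    where open ≡-Reasoning

  -- Uniqueness of binary expansions.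
  same-colours : ∀ {χ χ′ k cs cs′} → SameShape cs cs′ → Good χ k cs → Good χ′ k cs′ →
    length (members true cs) ≡ length (members true cs′) → cs ≡ cs′
  same-colours []           []           []            eq = refl
  same-colours (skip shape) (skip G)     (skip G′)     eq = cong (nothing ∷_) (same-colours shape G G′ eq)
  same-colours (full {true}  {true}  {g} shape) (full _ _ G) (full _ _ G′) eq =
    cong (_ ∷_) (same-colours shape G G′ (+-cancelˡ-≡ (length g) _ _
      (trans (sym (length-++ g)) (trans eq (length-++ g)))))
  same-colours (full {false} {false} shape) (full _ _ G) (full _ _ G′) eq =
    cong (_ ∷_) (same-colours shape G G′ eq)
  same-colours (full {true}  {false} {g} shape) (full e _ G) (full _ _ G′) eq =
    contradiction eq (slot-parity g e G G′)
  same-colours (full {false} {true}  {g} shape) (full _ _ G) (full e _ G′) eq =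
    contradiction (sym eq) (slot-parity g e G′ G)

  -- Runs that differ by exchanged blocks

  twin-halves : ∀ {χ bs bs′} → GoodBlocks χ bs → Pointwise Twin bs bs′ → halves bs ≡ halves bs′
  twin-halves []      []             = refl
  twin-halves (_ ∷ B) (same {t} ∷ twins)    = cong (length t +_) (twin-halves B twins)
  twin-halves ((_ , et , ef , _) ∷ B) (swapped ∷ twins) =
    cong₂ _+_ (trans et (sym ef)) (twin-halves B twins)

  first-swap : ∀ {bs bs′} → Pointwise Twin bs bs′ → bs ≡ bs′ ⊎
    ∃[ pre ] ∃[ t ] ∃[ f ] ∃[ post ] ∃[ post′ ]
      bs ≡ pre ++ (t , f) ∷ post × bs′ ≡ pre ++ (f , t) ∷ post′
  first-swap []                = inj₁ refl
  first-swap (swapped ∷ twins) = inj₂ ([] , _ , _ , _ , _ , refl , refl)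
  first-swap (same {t} {f} ∷ twins) with first-swap twins
  ... | inj₁ eq = inj₁ (cong (_ ∷_) eq)
  ... | inj₂ (pre , t′ , f′ , post , post′ , eq , eq′) =
    inj₂ ((t , f) ∷ pre , t′ , f′ , post , post′ , cong (_ ∷_) eq , cong (_ ∷_) eq′)

  -- The witness `p` is the last vertex of the common prefix, which therefore has to be non-empty.
  fork : ∀ w ws (a b : V) r r′ →
    ∃[ p ] Adj p b ((w ∷ ws) ++ b ∷ r′) × Skip p b ((w ∷ ws) ++ a ∷ b ∷ r)
  fork w []        a b r r′ = w , here , here
  fork w (w′ ∷ ws) a b r r′ with fork w′ ws a b r r′
  ... | p , adj , sk = p , there adj , there sk

  fork-blocks : ∀ w ws {χ} t f rest rest′ → GoodBlock χ (t , f) →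
    Crossing ((w ∷ ws) ++ zig t f ++ rest) ((w ∷ ws) ++ zig f t ++ rest′)
  -- After the prefix one path continues with `a`, `b` and the other with `b`, `a`.
  fork-blocks w ws (a ∷ t) (b ∷ f) rest rest′ _
    with fork w ws a b (zig t f ++ rest) (a ∷ zig f t ++ rest′)
  ... | p , a , s = p , b , inj₂ (a , s)
  fork-blocks w ws []      f       rest rest′ (_ , () , _)
  fork-blocks w ws (_ ∷ _) []      rest rest′ (_ , _ , () , _)

  swap-crossing : ∀ {χ} cs pre t f post post′ → AlternatingState (cs , []) →
    GoodBlock χ (t , f) →
    Crossing (path (cs , pre ++ (t , f) ∷ post)) (path (cs , pre ++ (f , t) ∷ post′))
  swap-crossing cs pre t f post post′ alt b
    -- `alt` rules out the empty list, so there is a vertex before the first block.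
    with members false cs
  ... | w ∷ ws =
    subst₂ Crossing (regroup (t , f) post) (regroup (f , t) post′)
      (fork-blocks w (zig (members true cs) ws ++ zigs pre) t f (zigs post) (zigs post′) b)
    where
    regroup : ∀ b bs →
      (w ∷ zig (members true cs) ws ++ zigs pre) ++ uncurry zig b ++ zigs bs ≡
      w ∷ zig (members true cs) ws ++ zigs (pre ++ b ∷ bs)
    regroup b bs = cong (w ∷_) (trans (++-assoc (zig (members true cs) ws) _ _)
      (cong (zig (members true cs) ws ++_) (sym (concatMap-++ (uncurry zig) pre (b ∷ bs)))))

  -- The counter records the colour of each group, and both colourings are constant on the group
  -- with that value.
  agree-flat : ∀ {χ χ′ k cs} → Good χ k cs → Good χ′ k cs → All (λ v → χ v ≡ χ′ v) (flat cs)
  agree-flat []           []             = []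
  agree-flat (skip G)     (skip G′)      = agree-flat G G′
  agree-flat (full _ m G) (full _ m′ G′) =
    All.++⁺ (All.zipWith (λ (p , q) → trans p (sym q)) (m , m′)) (agree-flat G G′)

  agree-blocks : ∀ {χ χ′ bs} → GoodBlocks χ bs → GoodBlocks χ′ bs →
    All (λ v → χ v ≡ χ′ v) (concatMap (uncurry _++_) bs)
  agree-blocks []      []       = []
  agree-blocks ((_ , _ , _ , t , f) ∷ B) ((_ , _ , _ , t′ , f′) ∷ B′) =
    All.++⁺ (All.++⁺ (agree t t′) (agree f f′)) (agree-blocks B B′)
    where
    agree : ∀ {χ χ′ c xs} → Mono χ c xs → Mono χ′ c xs → All (λ v → χ v ≡ χ′ v) xs
    agree m m′ = All.zipWith (λ (p , q) → trans p (sym q)) (m , m′)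

  Balanced : (V → Bool) → List V → Set
  Balanced χ vs = count false χ vs ≡ suc (count true χ vs)

  -- Blocks contribute equally to both tallies; cancelling them leaves the surplus of one false
  -- vertex in the counter.
  run-alternating : ∀ χ vs → Balanced χ vs → AlternatingState (run χ vs)
  run-alternating χ vs bal = +-cancelʳ-≡ (halves (proj₂ (run χ vs))) _ _
    (trans (run-tally false χ vs) (trans bal (cong suc (sym (run-tally true χ vs)))))

  crossing : ∀ χ χ′ vs → Balanced χ vs → Balanced χ′ vs → count true χ vs ≡ count true χ′ vs →
    All (λ v → χ v ≡ χ′ v) vs ⊎ Crossing (path (run χ vs)) (path (run χ′ vs))
  crossing χ χ′ vs bal bal′ eq with run-similar χ χ′ vs
  ... | inj₂ (x , y , inj₁ (j , n)) = inj₂ (x , y , inj₁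
    (joined-path (run χ vs) j , near-path (run χ′ vs) (proj₂ (run-good χ′ vs)) (run-alternating χ′ vs bal′) n))
  ... | inj₂ (x , y , inj₂ (j , n)) = inj₂ (x , y , inj₂
    (joined-path (run χ′ vs) j , near-path (run χ vs) (proj₂ (run-good χ vs)) (run-alternating χ vs bal) n))
  ... | inj₁ (shape , twins)
    with run χ vs | run χ′ vs | run-good χ vs | run-good χ′ vs | run-content χ vs
       | run-tally true χ vs | run-tally true χ′ vs | run-alternating χ vs bal
  ... | cs , bs | cs′ , bs′ | G , B | G′ , B′ | content | tl | tl′ | alt
    -- Equal numbers of trues overall and in the blocks leave equal numbers of trues in the two
    -- counters.
    with same-colours shape G G′ (+-cancelʳ-≡ (halves bs) _ _
           (trans tl (trans eq (trans (sym tl′) (cong (_ +_) (sym (twin-halves B twins)))))))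
  ... | refl with first-swap twins
  ... | inj₁ refl = inj₁ (All-resp-↭ content (All.++⁺ (agree-flat G G′) (agree-blocks B B′)))
  ... | inj₂ (pre , t , f , post , post′ , refl , refl) =
    inj₂ (swap-crossing cs pre t f post post′ alt (All.head (All.++⁻ʳ pre B)))

-- Hamiltonian paths from lists

unique-lookup : ∀ {A : Set} {xs : List A} → Unique xs → ∀ i j → lookup xs i ≡ lookup xs j → i ≡ j
unique-lookup (_ ∷ _)     zero    zero    _  = refl
unique-lookup (x∉xs ∷ _)  zero    (suc j) eq = contradiction eq (All.lookup x∉xs (∈-lookup j))
unique-lookup (x∉xs ∷ _)  (suc i) zero    eq = contradiction (sym eq) (All.lookup x∉xs (∈-lookup i))
unique-lookup (_ ∷ uniq)  (suc i) (suc j) eq = cong suc (unique-lookup uniq i j eq)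

cast-injective : ∀ {m n} (eq : m ≡ n) {i j} → cast eq i ≡ cast eq j → i ≡ j
cast-injective eq {i} {j} p =
  trans (sym (cast-involutive (sym eq) eq i)) (trans (cong (cast (sym eq)) p) (cast-involutive (sym eq) eq j))

fromList : ∀ {n} (xs : List (Fin n)) → Unique xs → length xs ≡ n → HamPath n
fromList xs uniq len .ord i  = lookup xs (cast (sym len) i)
fromList xs uniq len .inj eq = cast-injective (sym len) (unique-lookup uniq _ _ eq)

adj-lookup : ∀ {A : Set} {x y : A} {xs} → Adj x y xs → ∃[ i ] ∃[ j ] toℕ j ≡ suc (toℕ i) ×
  (lookup xs i ≡ x × lookup xs j ≡ y ⊎ lookup xs i ≡ y × lookup xs j ≡ x)
adj-lookup here      = zero , suc zero , refl , inj₁ (refl , refl)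
adj-lookup swap      = zero , suc zero , refl , inj₂ (refl , refl)
adj-lookup (there a) with adj-lookup a
... | i , j , eq , e = suc i , suc j , cong suc eq , e

adj-edge : ∀ {n x y} {xs : List (Fin n)} (uniq : Unique xs) (len : length xs ≡ n) →
  Adj x y xs → PathEdge (fromList xs uniq len) x y
adj-edge {x = x} {y} {xs} uniq len a with adj-lookup a
... | i , j , eq , e = cast len i , cast len j ,
  trans (toℕ-cast len j) (trans eq (cong suc (sym (toℕ-cast len i)))) ,
  subst₂ (λ i′ j′ → lookup xs i′ ≡ x × lookup xs j′ ≡ y ⊎ lookup xs i′ ≡ y × lookup xs j′ ≡ x)
    (sym (cast-involutive (sym len) len i)) (sym (cast-involutive (sym len) len j)) e

skip-middle : ∀ {A : Set} {x y : A} {xs} → Skip x y xs → ∃[ z ] Adj x z xs × Adj z y xs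
skip-middle (here {z}) = z , here , there here
skip-middle (swap {z}) = z , there swap , swap
skip-middle (there s)  with skip-middle s
... | z , a , b = z , there a , there b

adj-distinct : ∀ {A : Set} {x y : A} {xs} → Unique xs → Adj x y xs → x ≢ y
adj-distinct ((x≢y ∷ _) ∷ _) here      = x≢y
adj-distinct ((y≢x ∷ _) ∷ _) swap      = y≢x ∘ sym
adj-distinct (_ ∷ uniq)      (there a) = adj-distinct uniq a

crossing-triangle : ∀ {n} {xs ys : List (Fin n)} (ux : Unique xs) (lx : length xs ≡ n)
  (uy : Unique ys) (ly : length ys ≡ n) → Crossing xs ys →
  UnionHasTriangle (fromList xs ux lx) (fromList ys uy ly)
crossing-triangle ux lx uy ly (u , v , inj₁ (adj , sk)) with skip-middle sk
... | z , a , b = u , z , v , adj-distinct uy a , adj-distinct uy b , adj-distinct ux adj ,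
  inj₂ (adj-edge uy ly a) , inj₂ (adj-edge uy ly b) , inj₁ (adj-edge ux lx adj)
crossing-triangle ux lx uy ly (u , v , inj₂ (adj , sk)) with skip-middle sk
... | z , a , b = u , z , v , adj-distinct ux a , adj-distinct ux b , adj-distinct uy adj ,
  inj₁ (adj-edge ux lx a) , inj₁ (adj-edge ux lx b) , inj₂ (adj-edge uy ly adj)

crossing-++ : ∀ {V : Set} {xs ys : List V} zs → Crossing xs ys → Crossing (xs ++ zs) (ys ++ zs)
crossing-++ zs (u , v , inj₁ (adj , sk)) = u , v , inj₁ (adj-++ˡ zs adj , skip-++ˡ zs sk)
crossing-++ zs (u , v , inj₂ (adj , sk)) = u , v , inj₂ (adj-++ˡ zs adj , skip-++ˡ zs sk)

-- Words with a prescribed number of trues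

bit : Bool → ℕ
bit true  = 1
bit false = 0

trues : ∀ {n} → (Fin n → Bool) → ℕ
trues χ = sum (bit ∘ χ)

words : (n k : ℕ) → List (Vec Bool n)
words zero    zero    = [ [] ]
words zero    (suc k) = []
words (suc n) zero    = map (false ∷_) (words n zero)
words (suc n) (suc k) = map (true ∷_) (words n k) ++ map (false ∷_) (words n (suc k))

length-words : ∀ n k → length (words n k) ≡ n C k
length-words zero    zero    = refl
length-words zero    (suc k) = refl
length-words (suc n) zero    = trans (length-map _ (words n zero)) (length-words n zero)
length-words (suc n) (suc k) = begin
  length (map (true ∷_) (words n k) ++ map (false ∷_) (words n (suc k)))
    ≡⟨ length-++ (map (true ∷_) (words n k)) ⟩
  length (map (true ∷_) (words n k)) + length (map (false ∷_) (words n (suc k)))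
    ≡⟨ cong₂ _+_ (length-map _ (words n k)) (length-map _ (words n (suc k))) ⟩
  length (words n k) + length (words n (suc k))
    ≡⟨ cong₂ _+_ (length-words n k) (length-words n (suc k)) ⟩
  n C k + n C suc k
    ≡⟨ nCk+nC[k+1]≡[n+1]C[k+1] n k ⟩
  suc n C suc k ∎
  where open ≡-Reasoning

words-unique : ∀ n k → Unique (words n k)
words-unique zero    zero    = [] ∷ []
words-unique zero    (suc k) = []
words-unique (suc n) zero    = Unique.map⁺ Vec.∷-injectiveʳ (words-unique n zero)
words-unique (suc n) (suc k) =
  Unique.++⁺ (Unique.map⁺ Vec.∷-injectiveʳ (words-unique n k))
             (Unique.map⁺ Vec.∷-injectiveʳ (words-unique n (suc k)))
             (λ (p , q) → disjoint (∈-map⁻ _ p) (∈-map⁻ _ q))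
  where
  disjoint : ∀ {w} → ∃[ v ] v ∈ words n k × w ≡ true ∷ v → ¬ (∃[ v ] v ∈ words n (suc k) × w ≡ false ∷ v)
  disjoint (_ , _ , refl) (_ , _ , ())

words-trues : ∀ n k → All (λ w → trues (Vec.lookup w) ≡ k) (words n k)
words-trues zero    zero    = refl ∷ []
words-trues zero    (suc k) = []
words-trues (suc n) zero    = All.map⁺ (words-trues n zero)
words-trues (suc n) (suc k) =
  All.++⁺ (All.map⁺ (All.map (cong suc) (words-trues n k))) (All.map⁺ (words-trues n (suc k)))

false∷-∈ : ∀ {n k} {w : Vec Bool n} → w ∈ words n k → false ∷ w ∈ words (suc n) k
false∷-∈ {k = zero}          w∈ = ∈-map⁺ (false ∷_) w∈
false∷-∈ {n = n} {k = suc k} w∈ = ∈-++⁺ʳ (map (true ∷_) (words n k)) (∈-map⁺ (false ∷_) w∈)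

∈-words : ∀ {n} (χ : Fin n → Bool) → Vec.tabulate χ ∈ words n (trues χ)
∈-words {zero}  χ = here refl
∈-words {suc n} χ with χ zero
... | true  = ∈-++⁺ˡ (∈-map⁺ (true ∷_) (∈-words (χ ∘ suc)))
... | false = false∷-∈ (∈-words (χ ∘ suc))

-- The lower bound

count-tabulate : ∀ {V : Set} {n} (χ : V → Bool) (f : Fin n → V) →
  count true χ (tabulate f) ≡ trues (χ ∘ f)
count-tabulate {n = zero}  χ f = refl
count-tabulate {n = suc n} χ f with χ (f zero)
... | true  = cong suc (count-tabulate χ (f ∘ suc))
... | false = count-tabulate χ (f ∘ suc)

count-complement : ∀ {V : Set} (χ : V → Bool) vs → count false χ vs + count true χ vs ≡ length vs
count-complement χ []       = refl
count-complement χ (v ∷ vs) with χ v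
... | true  = trans (+-suc _ _) (cong suc (count-complement χ vs))
... | false = cong suc (count-complement χ vs)

double-+ : ∀ m → m * 2 ≡ m + m
double-+ m = trans (*-comm m 2) (cong (m +_) (+-identityʳ m))

unique-↭ : ∀ {n} {xs : List (Fin n)} → xs ↭ allFin n → Unique xs
unique-↭ p = Permutationₛ.Unique-resp-↭ (setoid _) (↭⇒↭ₛ (↭-sym p)) (Unique.allFin⁺ _)

-- Serves both parities: for odd `n`, `f` is the identity and `extra` is empty; for even `n`, `f` is
-- `suc` and `extra` holds vertex zero, appended at the end of every path.
module _ {n : ℕ} (m : ℕ) (f : Fin (suc (m * 2)) → Fin n) (extra : List (Fin n))
         (spanning : tabulate f ++ extra ↭ allFin n)
         (colouring : Vec Bool (suc (m * 2)) → Fin n → Bool)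
         (colouring-f : ∀ w i → colouring w (f i) ≡ Vec.lookup w i) where

  private
    vs = tabulate f

  vertices : Vec Bool (suc (m * 2)) → List (Fin n)
  vertices w = path (run (colouring w) vs) ++ extra

  vertices-↭ : ∀ w → vertices w ↭ allFin n
  vertices-↭ w = ↭-trans (++⁺ʳ extra (↭-trans (path-↭ (run (colouring w) vs)) (run-content (colouring w) vs))) spanning

  vertices-unique : ∀ w → Unique (vertices w)
  vertices-unique w = unique-↭ (vertices-↭ w)

  vertices-length : ∀ w → length (vertices w) ≡ n
  vertices-length w = trans (↭-length (vertices-↭ w)) (length-tabulate id)

  wordPath : Vec Bool (suc (m * 2)) → HamPath n
  wordPath w = fromList (vertices w) (vertices-unique w) (vertices-length w)

  count-word : ∀ w → trues (Vec.lookup w) ≡ m → count true (colouring w) vs ≡ m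
  count-word w eq = trans (count-tabulate (colouring w) f)
    (trans (sum-cong-≗ (λ i → cong bit (colouring-f w i))) eq)

  balanced-word : ∀ w → trues (Vec.lookup w) ≡ m → Balanced (colouring w) vs
  balanced-word w eq = +-cancelʳ-≡ m _ _ (begin
    count false χ vs + m                ≡⟨ cong (count false χ vs +_) (count-word w eq) ⟨
    count false χ vs + count true χ vs  ≡⟨ count-complement χ vs ⟩
    length vs                           ≡⟨ length-tabulate f ⟩
    suc (m * 2)                         ≡⟨ cong suc (double-+ m) ⟩
    suc (m + m)                         ≡⟨ cong (λ c → suc (c + m)) (count-word w eq) ⟨
    suc (count true χ vs) + m           ∎)
    where
    open ≡-Reasoning
    χ = colouring w

  wordPath-triangle : ∀ w w′ → trues (Vec.lookup w) ≡ m → trues (Vec.lookup w′) ≡ m → w ≢ w′ →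
    UnionHasTriangle (wordPath w) (wordPath w′)
  wordPath-triangle w w′ eq eq′ w≢w′
    with crossing (colouring w) (colouring w′) vs (balanced-word w eq) (balanced-word w′ eq′)
           (trans (count-word w eq) (sym (count-word w′ eq′)))
  ... | inj₂ cross = crossing-triangle (vertices-unique w) (vertices-length w)
    (vertices-unique w′) (vertices-length w′) (crossing-++ extra cross)
  -- Agreement of the colourings on the image of `f` would make the two words equal.
  ... | inj₁ agree = contradiction
    (trans (sym (Vec.tabulate∘lookup w)) (trans (Vec.tabulate-cong λ i →
      trans (sym (colouring-f w i)) (trans (All.lookup agree (∈-tabulate⁺ {f = f} i)) (colouring-f w′ i)))
      (Vec.tabulate∘lookup w′))) w≢w′

-- Proper colourings

Proper : ∀ {n} → HamPath n → (Fin n → Bool) → Set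
Proper P χ = ∀ u v → PathEdge P u v → χ u ≢ χ v

no-three : (a b c : Bool) → a ≢ b → b ≢ c → a ≢ c → ⊥
no-three true  true  _     a≢b _   _   = a≢b refl
no-three false false _     a≢b _   _   = a≢b refl
no-three _     true  true  _   b≢c _   = b≢c refl
no-three _     false false _   b≢c _   = b≢c refl
no-three true  _     true  _   _   a≢c = a≢c refl
no-three false _     false _   _   a≢c = a≢c refl

no-triangle : ∀ {n} (P Q : HamPath n) {χ} → Proper P χ → Proper Q χ → ¬ UnionHasTriangle P Q
no-triangle P Q {χ} p q (x , y , z , _ , _ , _ , xy , yz , xz) =
  no-three (χ x) (χ y) (χ z) (proper xy) (proper yz) (proper xz)
  where
  proper : ∀ {u v} → UnionEdge P Q u v → χ u ≢ χ v
  proper (inj₁ e) = p _ _ e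
  proper (inj₂ e) = q _ _ e

-- If `v` were missed, removing it from the codomain would give an injection into a set with one
-- element fewer.
surjective : ∀ {n} {f : Fin n → Fin n} → Injective _≡_ _≡_ f → ∀ v → ∃[ i ] f i ≡ v
surjective {suc n} {f} f-inj v with any? (λ i → f i ≟ v)
... | yes hit  = hit
... | no  miss = contradiction (injective⇒≤ (λ {i} {j} eq → f-inj (punchOut-injective (avoid i) (avoid j) eq))) 1+n≰n
  where
  avoid : ∀ i → v ≢ f i
  avoid i eq = miss (i , sym eq)

position : ∀ {n} → HamPath n → Fin n → Fin n
position P v = proj₁ (surjective (inj P) v)

ord-position : ∀ {n} (P : HamPath n) v → ord P (position P v) ≡ v
ord-position P v = proj₂ (surjective (inj P) v)

position-ord : ∀ {n} (P : HamPath n) i → position P (ord P i) ≡ i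
position-ord P i = inj P (ord-position P (ord P i))

shade : Bool → ℕ → Bool
shade c zero    = c
shade c (suc k) = shade (not c) k

shade-not : ∀ c k → shade (not c) k ≡ not (shade c k)
shade-not c zero    = refl
shade-not c (suc k) = shade-not (not c) k

shading : ∀ {n} → Bool → HamPath n → Fin n → Bool
shading c P v = shade c (toℕ (position P v))

shading-proper : ∀ {n} c (P : HamPath n) → Proper P (shading c P)
shading-proper c P u v (i , j , j≡1+i , ends) = λ eq → differ ends eq
  where
  shade-ord : ∀ {k x} → ord P k ≡ x → shading c P x ≡ shade c (toℕ k)
  shade-ord {k} refl = cong (shade c ∘ toℕ) (position-ord P k)

  next : shade c (toℕ j) ≡ not (shade c (toℕ i))
  next = trans (cong (shade c) j≡1+i) (shade-not c (toℕ i))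

  differ : ord P i ≡ u × ord P j ≡ v ⊎ ord P i ≡ v × ord P j ≡ u → shading c P u ≢ shading c P v
  differ (inj₁ (iu , jv)) eq = not-¬ refl (trans (sym (shade-ord iu)) (trans eq (trans (shade-ord jv) next)))
  differ (inj₂ (iv , ju)) eq = not-¬ refl (trans (sym (shade-ord iv)) (trans (sym eq) (trans (shade-ord ju) next)))

trues-shade : ∀ c m → trues {m * 2} (shade c ∘ toℕ) ≡ m
trues-shade c     zero    = refl
trues-shade true  (suc m) = cong suc (trues-shade true m)
trues-shade false (suc m) = cong suc (trues-shade false m)

-- The order of the path is a permutation, so the trues can be counted by position instead of by
-- vertex.
trues-shading : ∀ {n} c (P : HamPath n) → trues (shading c P) ≡ trues {n} (shade c ∘ toℕ)
trues-shading c P = trans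
  (sum-permute (bit ∘ shading c P) (permutation (ord P) (position P) (ord-position P) (position-ord P)))
  (sum-cong-≗ (λ i → cong (bit ∘ shade c ∘ toℕ) (position-ord P i)))

-- Assembling the family and bounding every family

-- With equal edge sets, one proper colouring would serve both paths and make the union bipartite.
-- So the triangles already guarantee that the paths of the family are distinct.
same-edges-no-triangle : ∀ {n} (P Q : HamPath n) → UnionHasTriangle P Q → ¬ SameEdges P Q
same-edges-no-triangle P Q triangle edges = no-triangle P Q
  (shading-proper true P) (λ u v e → shading-proper true P u v (proj₂ (edges u v) e)) triangle

lookup-words : ∀ n k i → trues (Vec.lookup (lookup (words n k) i)) ≡ k
lookup-words n k i = All.lookup (words-trues n k) (∈-lookup i)

family : ∀ {n} m (P : Vec Bool (suc (m * 2)) → HamPath n) →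
  (∀ w w′ → trues (Vec.lookup w) ≡ m → trues (Vec.lookup w′) ≡ m → w ≢ w′ → UnionHasTriangle (P w) (P w′)) →
  Σ ℕ λ k → Σ (Fin k → HamPath n) λ F → TriangleFamily k F × k ≡ length (words (suc (m * 2)) m)
family m P triangle = length ws , F , triangles , refl
  where
  ws = words (suc (m * 2)) m
  F  = P ∘ lookup ws

  triangles : TriangleFamily (length ws) F
  triangles i j i≢j = same-edges-no-triangle (F i) (F j) tri , tri
    where
    tri = triangle _ _ (lookup-words (suc (m * 2)) m i) (lookup-words (suc (m * 2)) m j)
            (i≢j ∘ unique-lookup (words-unique (suc (m * 2)) m) i j)

-- Pigeonhole: two members with the same code share a proper colouring, so their union has no
-- triangle. The code is kept apart from the colouring so that it may omit a vertex whose colour is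
-- fixed.
bounded : ∀ {n} N k (χ : HamPath n → Fin n → Bool) → (∀ P → Proper P (χ P)) →
  (code : HamPath n → Vec Bool N) → (∀ P → code P ∈ words N k) →
  (∀ P Q → code P ≡ code Q → ∀ v → χ P v ≡ χ Q v) →
  ∀ s (F : Fin s → HamPath n) → TriangleFamily s F → s ≤ length (words N k)
bounded N k χ proper code code∈ determines s F fam = injective⇒≤ slot-injective
  where
  slot : Fin s → Fin (length (words N k))
  slot i = index (code∈ (F i))

  slot-injective : Injective _≡_ _≡_ slot
  slot-injective {i} {j} eq with i ≟ j
  ... | yes i≡j = i≡j
  ... | no  i≢j = contradiction (proj₂ (fam i j i≢j)) (no-triangle (F i) (F j) (proper (F i))
    (λ u v e p → proper (F j) u v e (trans (sym (agree u)) (trans p (agree v)))))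
    where
    agree = determines (F i) (F j) (trans (Any.lookup-index (code∈ (F i)))
      (trans (cong (lookup (words N k)) eq) (sym (Any.lookup-index (code∈ (F j))))))

tabulate-≗ : ∀ {n} (f g : Fin n → Bool) → Vec.tabulate f ≡ Vec.tabulate g → ∀ i → f i ≡ g i
tabulate-≗ f g eq i =
  trans (sym (Vec.lookup∘tabulate f i)) (trans (cong (λ w → Vec.lookup w i) eq) (Vec.lookup∘tabulate g i))

-- Odd and even numbers of vertices

Extremal : ℕ → ℕ → Set
Extremal n b =
  (Σ ℕ λ k → Σ (Fin k → HamPath n) λ F → TriangleFamily k F × k ≡ b)
  × (∀ k (F : Fin k → HamPath n) → TriangleFamily k F → k ≤ b)

extremal-odd : ∀ m → Extremal (suc (m * 2)) (length (words (suc (m * 2)) m))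
extremal-odd m =
  family m (wordPath m id [] (↭-reflexive (++-identityʳ _)) Vec.lookup (λ _ _ → refl))
           (wordPath-triangle m id [] (↭-reflexive (++-identityʳ _)) Vec.lookup (λ _ _ → refl)) ,
  bounded (suc (m * 2)) m (shading false) (shading-proper false) (Vec.tabulate ∘ shading false)
    -- The first vertex of the path is false; the other `m * 2` alternate starting with true, which
    -- gives `m` trues.
    (λ P → subst (λ k → Vec.tabulate (shading false P) ∈ words _ k)
      (trans (trues-shading false P) (trues-shade true m)) (∈-words (shading false P)))
    (λ P Q → tabulate-≗ (shading false P) (shading false Q))

-- With an even number of vertices the two colour classes have the same size, and the class of
-- vertex zero is taken to be the true one.
normal : ∀ {n} → HamPath (suc n) → Fin (suc n) → Bool
normal P = shading (shading true P zero) P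

normal-zero : ∀ {n} (P : HamPath (suc n)) → normal P zero ≡ true
-- Vertex zero at position `k` has the starting colour flipped `k` times, and the starting colour is
-- itself true flipped `k` times.
normal-zero P = shade-shade (toℕ (position P zero))
  where
  shade-shade : ∀ k → shade (shade true k) k ≡ true
  shade-shade k with shade true k in eq
  ... | true  = eq
  ... | false = trans (shade-not true k) (cong not eq)

trues-normal : ∀ {m} (P : HamPath (suc m * 2)) → trues (normal P ∘ suc) ≡ m
trues-normal {m} P = suc-injective (begin
  suc (trues (normal P ∘ suc))                   ≡⟨ cong (λ c → bit c + trues (normal P ∘ suc)) (normal-zero P) ⟨
  trues (normal P)                               ≡⟨ trues-shading (shading true P zero) P ⟩
  trues {suc m * 2} (shade (shading true P zero) ∘ toℕ) ≡⟨ trues-shade (shading true P zero) (suc m) ⟩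
  suc m                                          ∎)
  where open ≡-Reasoning

extremal-even : ∀ m → Extremal (suc m * 2) (length (words (suc (m * 2)) m))
extremal-even m =
  family m (wordPath m suc [ zero ] spanning extend (λ _ _ → refl))
           (wordPath-triangle m suc [ zero ] spanning extend (λ _ _ → refl)) ,
  bounded (suc (m * 2)) m normal (λ P → shading-proper _ P) (λ P → Vec.tabulate (normal P ∘ suc))
    (λ P → subst (λ k → Vec.tabulate (normal P ∘ suc) ∈ words _ k) (trues-normal {m} P) (∈-words (normal P ∘ suc)))
    determines
  where
  spanning : tabulate suc ++ [ zero ] ↭ allFin (suc m * 2)
  spanning = ++-comm (tabulate suc) [ zero ]

  extend : Vec Bool (suc (m * 2)) → Fin (suc m * 2) → Bool
  -- A default value: the run inserts only the vertices `suc i`.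
  extend w zero    = false
  extend w (suc i) = Vec.lookup w i

  determines : ∀ (P Q : HamPath (suc m * 2)) →
    Vec.tabulate (normal P ∘ suc) ≡ Vec.tabulate (normal Q ∘ suc) → ∀ v → normal P v ≡ normal Q v
  determines P Q eq zero    = trans (normal-zero P) (sym (normal-zero Q))
  determines P Q eq (suc v) = tabulate-≗ (normal P ∘ suc) (normal Q ∘ suc) eq v

count-bipartitions : ∀ n m → (n ∸ 1) / 2 ≡ m → length (words (suc (m * 2)) m) ≡ balancedBipartitions n
count-bipartitions n m refl = trans (length-words (suc (m * 2)) m)
  (cong (_C m) (trans (cong suc (*-comm m 2)) (+-comm 1 (2 * m))))

half-odd : ∀ m → suc (m * 2) / 2 ≡ m
half-odd m = trans (+-distrib-/-∣ʳ 1 {m * 2} {2} (n∣m*n m)) (m*n/n≡m m 2)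

parity : ∀ n → ∃[ m ] (n ≡ m * 2 ⊎ n ≡ suc (m * 2))
parity zero = 0 , inj₁ refl
parity (suc n) with parity n
... | m , inj₁ refl = m , inj₂ refl
... | m , inj₂ refl = suc m , inj₁ refl

theorem1p4 : (n : ℕ) → 2 ≤ n →
    (Σ ℕ λ k → Σ (Fin k → HamPath n) λ F → TriangleFamily k F × k ≡ balancedBipartitions n)
    × (∀ k (F : Fin k → HamPath n) → TriangleFamily k F → k ≤ balancedBipartitions n)
-- `parity` is taken of one less than the number of vertices, so its even case leads to
-- `extremal-odd`.
theorem1p4 (suc n) _ with parity n
... | m , inj₁ refl = subst (Extremal (suc _)) (count-bipartitions (suc (m * 2)) m (m*n/n≡m m 2)) (extremal-odd m)
... | m , inj₂ refl = subst (Extremal (suc _)) (count-bipartitions (suc m * 2) m (half-odd m)) (extremal-even m)
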